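{- Let $s,t\ge 1$, $k=s+t+4$, and $n\ge k$. Let $Q(s,t)$ be the graph consisting of the $4$-cycle with edges $v_1v_2,v_2v_3,v_3v_4,v_4v_1$, together with $s$ pendant vertices adjacent only to $v_1$ and $t$ pendant vertices adjacent only to $v_2$ (so $Q(s,t)$ has $k$ vertices and $k$ edges). Let $\Gamma=(K_n,Q(s,t)^-)$. Then, with $u=n-k$, $$\varphi(\Gamma,\lambda)=(\lambda+1)^{n-7}\Big(\lambda^7+(7-n)\lambda^6+(21-6n)\lambda^5+(12k-15n+4ku+8st-13)\lambda^4+(48k-20n+16ku+32st-157)\lambda^3+(113n-56k-8ku-16st(u-1)-267)\lambda^2+(250n-208k-48ku-32st(u+1)-185)\lambda+127n-116k-28ku+24st(2u-1)-47\Big).$$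
   Context: For a subgraph $H$ of $K_n$, $(K_n,H^-)$ denotes $K_n$ with the edges of $H$ negative and all other edges positive; its adjacency matrix has entries $-1$ on edges of $H$, $+1$ on other pairs of distinct vertices, and $0$ on the diagonal. $\varphi(\Gamma,\lambda)=\det(\lambda I-A(\Gamma))$. -}

module Defs where

open import Data.Nat as ℕ using (ℕ; zero; suc; _≡ᵇ_; _<ᵇ_; _≤ᵇ_)
open import Data.Bool using (Bool; true; false; _∧_; _∨_; if_then_else_)
open import Data.Fin using (Fin; zero; suc; toℕ; punchIn)
open import Data.Integer using (ℤ; +_; -_; _+_; _-_; _*_; _^_)

Matrix : ℕ → Set
Matrix n = Fin n → Fin n → ℤ

sumFin : (n : ℕ) → (Fin n → ℤ) → ℤ
sumFin zero    f = + 0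
sumFin (suc n) f = f zero + sumFin n (λ j → f (suc j))

det : (n : ℕ) → Matrix n → ℤ
det zero    M = + 1
det (suc n) M =
  sumFin (suc n) (λ j → ((- + 1) ^ toℕ j) * (M zero j * det n (λ a b → M (suc a) (punchIn j b))))

idMat : (n : ℕ) → Matrix n
idMat n i j = if toℕ i ≡ᵇ toℕ j then + 1 else + 0

charPoly : (n : ℕ) → Matrix n → ℤ → ℤ
charPoly n A x = det n (λ i j → (x * idMat n i j) - A i j)

-- Labelling of Q(s,t) inside K_n (vertices 0..n-1):
--   v1 = 0, v2 = 1, v3 = 2, v4 = 3;
--   pendants of v1: 4 .. 3+s;  pendants of v2: 4+s .. 3+s+t;
--   the remaining vertices 4+s+t .. n-1 are not touched by Q(s,t).
inRange : ℕ → ℕ → ℕ → Bool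
inRange lo hi p = (lo ≤ᵇ p) ∧ (p <ᵇ hi)

QArc : ℕ → ℕ → ℕ → ℕ → Bool
QArc s t a b =
     ((a ≡ᵇ 0) ∧ (b ≡ᵇ 1))
  ∨ (((a ≡ᵇ 1) ∧ (b ≡ᵇ 2))
  ∨ (((a ≡ᵇ 2) ∧ (b ≡ᵇ 3))
  ∨ (((a ≡ᵇ 3) ∧ (b ≡ᵇ 0))
  ∨ (((a ≡ᵇ 0) ∧ inRange 4 (4 ℕ.+ s) b)
  ∨ ((a ≡ᵇ 1) ∧ inRange (4 ℕ.+ s) (4 ℕ.+ s ℕ.+ t) b)))))

QEdge : ℕ → ℕ → ℕ → ℕ → Bool
QEdge s t a b = QArc s t a b ∨ QArc s t b a

signedAdj : (s t n : ℕ) → Matrix n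
signedAdj s t n i j =
  if toℕ i ≡ᵇ toℕ j then + 0
  else (if QEdge s t (toℕ i) (toℕ j) then - + 1 else + 1)

septic : (s t n : ℕ) → ℤ → ℤ
septic s t n x =
  let S = + s ; T = + t ; N = + n
      k = s ℕ.+ t ℕ.+ 4
      K = + k ; U = + (n ℕ.∸ k) ; st = S * T
  in  x ^ 7
    + (+ 7 - N) * x ^ 6
    + (+ 21 - + 6 * N) * x ^ 5
    + (+ 12 * K - + 15 * N + + 4 * K * U + + 8 * st - + 13) * x ^ 4
    + (+ 48 * K - + 20 * N + + 16 * K * U + + 32 * st - + 157) * x ^ 3
    + (+ 113 * N - + 56 * K - + 8 * K * U - + 16 * st * (U - + 1) - + 267) * x ^ 2
    + (+ 250 * N - + 208 * K - + 48 * K * U - + 32 * st * (U + + 1) - + 185) * x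
    + (+ 127 * N - + 116 * K - + 28 * K * U + + 24 * st * (+ 2 * U - + 1) - + 47)

module Submission where

-- With y = λ + 1 we have λI − A(Γ) = yI + W, where W(a, b) = 1 if ab is an edge of Q(s,t) and
-- W(a, b) = −1 otherwise, the diagonal included. W depends only on the role of a vertex (v₁, …, v₄,
-- pendant at v₁, pendant at v₂, or outside Q), so vertices of equal role are twins. For
-- yI + diag(μ)W, two twins of weights μa and μb can be replaced by one vertex of weight μa + μb at
-- the cost of a factor y. Merging the s pendants at v₁, the t pendants at v₂ and the u = n − k
-- outside vertices leaves a 7 × 7 matrix with weights 1, 1, 1, 1, s, t, u (6 × 6 when u = 0),
-- whose determinant is expanded symbolically and compared with the septic by ring normalisation.

module Determinant where
  open import Defs
  open import Data.Bool using (true; false; if_then_else_; T)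
  open import Data.Empty using (⊥-elim)
  open import Data.Fin using (Fin; zero; suc; toℕ; punchIn; punchOut; inject₁; _≟_)
  open import Data.Fin.Properties
    using (suc-injective; toℕ-injective; toℕ-inject₁; punchIn-injective; punchInᵢ≢i; punchIn-punchOut)
  open import Data.Integer using (ℤ; +_; -_; _+_; _*_; _^_)
  open import Data.Integer.Properties using (*-zeroʳ; *-identityʳ; +-identityʳ; +-identityˡ; *-distribˡ-+; ^-distribˡ-+-*)
  open import Data.Integer.Tactic.RingSolver using (solve-∀)
  open import Data.Nat as ℕ using (ℕ; zero; suc; _≡ᵇ_)
  open import Data.Nat.Properties using (≡ᵇ⇒≡; ≡⇒≡ᵇ; +-suc; 1+n≢n)
  open import Data.Product using (Σ; _×_; _,_)
  open import Function using (_∘_)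
  open import Relation.Binary.PropositionalEquality
  open import Relation.Nullary using (yes; no; does)

  cong₃ : ∀ {A B C D : Set} (f : A → B → C → D) {a a′ b b′ c c′} →
    a ≡ a′ → b ≡ b′ → c ≡ c′ → f a b c ≡ f a′ b′ c′
  cong₃ f refl refl refl = refl

  sumFin-cong : ∀ n {f g : Fin n → ℤ} → (∀ j → f j ≡ g j) → sumFin n f ≡ sumFin n g
  sumFin-cong zero    f≡g = refl
  sumFin-cong (suc n) f≡g = cong₂ _+_ (f≡g zero) (sumFin-cong n (λ j → f≡g (suc j)))

  sumFin-zero : ∀ n {f : Fin n → ℤ} → (∀ j → f j ≡ + 0) → sumFin n f ≡ + 0
  sumFin-zero zero    f≡0 = refl
  sumFin-zero (suc n) f≡0 = cong₂ _+_ (f≡0 zero) (sumFin-zero n (λ j → f≡0 (suc j)))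

  sumFin-+ : ∀ n (f g : Fin n → ℤ) → sumFin n (λ j → f j + g j) ≡ sumFin n f + sumFin n g
  sumFin-+ zero    f g = refl
  sumFin-+ (suc n) f g = begin
    (f zero + g zero) + sumFin n (λ j → f (suc j) + g (suc j))
      ≡⟨ cong (_+_ (f zero + g zero)) (sumFin-+ n (λ j → f (suc j)) (λ j → g (suc j))) ⟩
    (f zero + g zero) + (sumFin n (λ j → f (suc j)) + sumFin n (λ j → g (suc j)))
      ≡⟨ swap-middle (f zero) (g zero) _ _ ⟩
    (f zero + sumFin n (λ j → f (suc j))) + (g zero + sumFin n (λ j → g (suc j))) ∎
    where
    open ≡-Reasoning
    swap-middle : ∀ a b c d → (a + b) + (c + d) ≡ (a + c) + (b + d)
    swap-middle = solve-∀

  *-distribˡ-sumFin : ∀ n (c : ℤ) (f : Fin n → ℤ) → c * sumFin n f ≡ sumFin n (λ j → c * f j)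
  *-distribˡ-sumFin zero    c f = *-zeroʳ c
  *-distribˡ-sumFin (suc n) c f =
    trans (*-distribˡ-+ c (f zero) _) (cong (_+_ (c * f zero)) (*-distribˡ-sumFin n c (λ j → f (suc j))))

  sumFin-punchIn : ∀ n (l : Fin (suc n)) (f : Fin (suc n) → ℤ) →
    sumFin (suc n) f ≡ f l + sumFin n (λ j → f (punchIn l j))
  sumFin-punchIn n       zero    f = refl
  sumFin-punchIn (suc n) (suc l) f =
    trans (cong (_+_ (f zero)) (sumFin-punchIn n l (λ j → f (suc j))))
          (swap-front (f zero) (f (suc l)) _)
    where
    swap-front : ∀ a b c → a + (b + c) ≡ b + (a + c)
    swap-front = solve-∀

  sumFin-cancelling-pair : ∀ n (k : Fin (suc n)) (f : Fin (suc (suc n)) → ℤ) →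
    (∀ j → j ≢ inject₁ k → j ≢ suc k → f j ≡ + 0) → f (inject₁ k) + f (suc k) ≡ + 0 →
    sumFin (suc (suc n)) f ≡ + 0
  sumFin-cancelling-pair n zero f rest≡0 pair≡0 = begin
    f zero + (f (suc zero) + sumFin n (λ j → f (suc (suc j))))
      ≡⟨ cong (λ r → f zero + (f (suc zero) + r)) (sumFin-zero n (λ j → rest≡0 (suc (suc j)) (λ ()) (λ ()))) ⟩
    f zero + (f (suc zero) + + 0)
      ≡⟨ cong (_+_ (f zero)) (+-identityʳ (f (suc zero))) ⟩
    f zero + f (suc zero)
      ≡⟨ pair≡0 ⟩
    + 0 ∎
    where open ≡-Reasoning
  sumFin-cancelling-pair (suc n) (suc k) f rest≡0 pair≡0 =
    cong₂ _+_ (rest≡0 zero (λ ()) (λ ()))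
      (sumFin-cancelling-pair n k (λ j → f (suc j))
        (λ j j≢k j≢k+1 → rest≡0 (suc j) (j≢k ∘ suc-injective) (j≢k+1 ∘ suc-injective)) pair≡0)

  sign : ℕ → ℤ
  sign k = (- + 1) ^ k

  sign-+ : ∀ a b → sign (a ℕ.+ b) ≡ sign a * sign b
  sign-+ = ^-distribˡ-+-* (- + 1)

  sign-double : ∀ m → sign (m ℕ.+ m) ≡ + 1
  sign-double m = trans (sign-+ m m) (square m)
    where
    square : ∀ m → sign m * sign m ≡ + 1
    square zero    = refl
    square (suc m) = trans (flip (sign m)) (square m)
      where
      flip : ∀ σ → (- + 1 * σ) * (- + 1 * σ) ≡ σ * σ
      flip = solve-∀

  minor : ∀ {n} → Matrix (suc n) → Fin (suc n) → Fin (suc n) → Matrix n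
  minor M r l a b = M (punchIn r a) (punchIn l b)

  -- det (suc n) M is definitionally sumFin (suc n) (cofactorTerm M).
  cofactorTerm : ∀ {n} → Matrix (suc n) → Fin (suc n) → ℤ
  cofactorTerm {n} M j = sign (toℕ j) * (M zero j * det n (minor M zero j))

  det-cong : ∀ n {M N : Matrix n} → (∀ i j → M i j ≡ N i j) → det n M ≡ det n N
  det-cong zero    M≡N = refl
  det-cong (suc n) M≡N = sumFin-cong (suc n) λ j →
    cong₂ (λ a d → sign (toℕ j) * (a * d)) (M≡N zero j) (det-cong n (λ a b → M≡N (suc a) (punchIn j b)))

  private
    distribʳ-term : ∀ σ a b d → σ * ((a + b) * d) ≡ σ * (a * d) + σ * (b * d)
    distribʳ-term = solve-∀

    distribˡ-term : ∀ σ a d e → σ * (a * (d + e)) ≡ σ * (a * d) + σ * (a * e)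
    distribˡ-term = solve-∀

  det-additive-cofactors : ∀ n (M N P : Matrix (suc n)) →
    (∀ j → cofactorTerm M j ≡ cofactorTerm N j + cofactorTerm P j) →
    det (suc n) M ≡ det (suc n) N + det (suc n) P
  det-additive-cofactors n M N P terms =
    trans (sumFin-cong (suc n) terms) (sumFin-+ (suc n) (cofactorTerm N) (cofactorTerm P))

  det-row-additive : ∀ n (r : Fin n) (M N P : Matrix n) →
    (∀ j → M r j ≡ N r j + P r j) →
    (∀ i j → i ≢ r → M i j ≡ N i j) → (∀ i j → i ≢ r → P i j ≡ N i j) →
    det n M ≡ det n N + det n P
  det-row-additive (suc n) zero M N P row M≡N P≡N = det-additive-cofactors n M N P λ j → begin
    sign (toℕ j) * (M zero j * det n (minor M zero j))
      ≡⟨ cong₂ (λ a d → sign (toℕ j) * (a * d)) (row j) (det-cong n (λ a b → M≡N (suc a) (punchIn j b) (λ ()))) ⟩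
    sign (toℕ j) * ((N zero j + P zero j) * det n (minor N zero j))
      ≡⟨ distribʳ-term (sign (toℕ j)) (N zero j) (P zero j) _ ⟩
    cofactorTerm N j + sign (toℕ j) * (P zero j * det n (minor N zero j))
      ≡⟨ cong (λ d → cofactorTerm N j + sign (toℕ j) * (P zero j * d))
              (sym (det-cong n (λ a b → P≡N (suc a) (punchIn j b) (λ ())))) ⟩
    cofactorTerm N j + cofactorTerm P j ∎
    where open ≡-Reasoning
  det-row-additive (suc n) (suc r) M N P row M≡N P≡N = det-additive-cofactors n M N P λ j → begin
    sign (toℕ j) * (M zero j * det n (minor M zero j))
      ≡⟨ cong₂ (λ a d → sign (toℕ j) * (a * d)) (M≡N zero j (λ ()))
           (det-row-additive n r (minor M zero j) (minor N zero j) (minor P zero j)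
             (λ b → row (punchIn j b))
             (λ a b a≢r → M≡N (suc a) (punchIn j b) (a≢r ∘ suc-injective))
             (λ a b a≢r → P≡N (suc a) (punchIn j b) (a≢r ∘ suc-injective))) ⟩
    sign (toℕ j) * (N zero j * (det n (minor N zero j) + det n (minor P zero j)))
      ≡⟨ distribˡ-term (sign (toℕ j)) (N zero j) _ _ ⟩
    cofactorTerm N j + sign (toℕ j) * (N zero j * det n (minor P zero j))
      ≡⟨ cong (λ a → cofactorTerm N j + sign (toℕ j) * (a * det n (minor P zero j))) (sym (P≡N zero j (λ ()))) ⟩
    cofactorTerm N j + cofactorTerm P j ∎
    where open ≡-Reasoning

  det-col-additive : ∀ n (l : Fin n) (M N P : Matrix n) →
    (∀ i → M i l ≡ N i l + P i l) →
    (∀ i j → j ≢ l → M i j ≡ N i j) → (∀ i j → j ≢ l → P i j ≡ N i j) →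
    det n M ≡ det n N + det n P
  det-col-additive (suc n) l M N P col M≡N P≡N = det-additive-cofactors n M N P term
    where
    open ≡-Reasoning
    term : ∀ j → cofactorTerm M j ≡ cofactorTerm N j + cofactorTerm P j
    term j with j ≟ l
    ... | yes refl = begin
      sign (toℕ j) * (M zero j * det n (minor M zero j))
        ≡⟨ cong₂ (λ a d → sign (toℕ j) * (a * d)) (col zero)
             (det-cong n (λ a b → M≡N (suc a) (punchIn j b) (punchInᵢ≢i j b))) ⟩
      sign (toℕ j) * ((N zero j + P zero j) * det n (minor N zero j))
        ≡⟨ distribʳ-term (sign (toℕ j)) (N zero j) (P zero j) _ ⟩
      cofactorTerm N j + sign (toℕ j) * (P zero j * det n (minor N zero j))
        ≡⟨ cong (λ d → cofactorTerm N j + sign (toℕ j) * (P zero j * d))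
                (sym (det-cong n (λ a b → P≡N (suc a) (punchIn j b) (punchInᵢ≢i j b)))) ⟩
      cofactorTerm N j + cofactorTerm P j ∎
    ... | no j≢l = begin
      sign (toℕ j) * (M zero j * det n (minor M zero j))
        ≡⟨ cong₂ (λ a d → sign (toℕ j) * (a * d)) (M≡N zero j j≢l)
             (det-col-additive n l′ (minor M zero j) (minor N zero j) (minor P zero j)
               (λ a → subst (λ c → M (suc a) c ≡ N (suc a) c + P (suc a) c) (sym l′↦l) (col (suc a)))
               (λ a b b≢l′ → M≡N (suc a) (punchIn j b) (b≢l′ ∘ punchIn-cancel))
               (λ a b b≢l′ → P≡N (suc a) (punchIn j b) (b≢l′ ∘ punchIn-cancel))) ⟩
      sign (toℕ j) * (N zero j * (det n (minor N zero j) + det n (minor P zero j)))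
        ≡⟨ distribˡ-term (sign (toℕ j)) (N zero j) _ _ ⟩
      cofactorTerm N j + sign (toℕ j) * (N zero j * det n (minor P zero j))
        ≡⟨ cong (λ a → cofactorTerm N j + sign (toℕ j) * (a * det n (minor P zero j))) (sym (P≡N zero j j≢l)) ⟩
      cofactorTerm N j + cofactorTerm P j ∎
      where
      l′ : Fin n
      l′ = punchOut j≢l
      l′↦l : punchIn j l′ ≡ l
      l′↦l = punchIn-punchOut j≢l
      punchIn-cancel : ∀ {b} → punchIn j b ≡ l → b ≡ l′
      punchIn-cancel {b} e = punchIn-injective j b l′ (trans e (sym l′↦l))

  det-zero-col : ∀ n (l : Fin n) (M : Matrix n) → (∀ i → M i l ≡ + 0) → det n M ≡ + 0
  det-zero-col n l M col≡0 = self-double (det-col-additive n l M M M doubled (λ _ _ _ → refl) (λ _ _ _ → refl))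
    where
    doubled : ∀ i → M i l ≡ M i l + M i l
    doubled i = trans (col≡0 i) (sym (cong₂ _+_ (col≡0 i) (col≡0 i)))
    self-double : ∀ {d} → d ≡ d + d → d ≡ + 0
    self-double {d} e = begin
      d              ≡⟨ add-sub d ⟩
      (d + d) + - d  ≡⟨ cong (λ z → z + - d) (sym e) ⟩
      d + - d        ≡⟨ sub-self d ⟩
      + 0            ∎
      where
      open ≡-Reasoning
      add-sub : ∀ d → d ≡ (d + d) + - d
      add-sub = solve-∀
      sub-self : ∀ d → d + - d ≡ + 0
      sub-self = solve-∀

  punchIn-suc-self : ∀ {n} (k : Fin (suc n)) → punchIn (suc k) k ≡ inject₁ k
  punchIn-suc-self {n}     zero    = refl
  punchIn-suc-self {suc n} (suc k) = cong suc (punchIn-suc-self k)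

  punchIn-inject₁-self : ∀ {n} (k : Fin (suc n)) → punchIn (inject₁ k) k ≡ suc k
  punchIn-inject₁-self {n}     zero    = refl
  punchIn-inject₁-self {suc n} (suc k) = cong suc (punchIn-inject₁-self k)

  punchIn-inject₁≡punchIn-suc : ∀ {n} (k p : Fin (suc n)) → p ≢ k → punchIn (inject₁ k) p ≡ punchIn (suc k) p
  punchIn-inject₁≡punchIn-suc         zero    zero    p≢k = ⊥-elim (p≢k refl)
  punchIn-inject₁≡punchIn-suc         zero    (suc p) p≢k = refl
  punchIn-inject₁≡punchIn-suc {suc n} (suc k) zero    p≢k = refl
  punchIn-inject₁≡punchIn-suc {suc n} (suc k) (suc p) p≢k = cong suc (punchIn-inject₁≡punchIn-suc k p (p≢k ∘ cong suc))

  inject₁≢suc : ∀ {n} (k : Fin n) → inject₁ k ≢ suc k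
  inject₁≢suc k e = 1+n≢n (sym (trans (sym (toℕ-inject₁ k)) (cong toℕ e)))

  punchIn-adjacent-pair : ∀ {n} (j : Fin (suc (suc n))) (k : Fin (suc n)) → j ≢ inject₁ k → j ≢ suc k →
    Σ (Fin n) λ k′ → punchIn j (inject₁ k′) ≡ inject₁ k × punchIn j (suc k′) ≡ suc k
  punchIn-adjacent-pair             zero          zero    j≢a j≢b = ⊥-elim (j≢a refl)
  punchIn-adjacent-pair {suc n}     zero          (suc k) j≢a j≢b = k , refl , refl
  punchIn-adjacent-pair             (suc zero)    zero    j≢a j≢b = ⊥-elim (j≢b refl)
  punchIn-adjacent-pair {suc n}     (suc (suc j)) zero    j≢a j≢b = zero , refl , refl
  punchIn-adjacent-pair {suc n}     (suc j)       (suc k) j≢a j≢b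
    with punchIn-adjacent-pair j k (j≢a ∘ cong suc) (j≢b ∘ cong suc)
  ... | k′ , a↦ , b↦ = suc k′ , cong suc a↦ , cong suc b↦

  punchIn-adjacent-twins : ∀ {n} {A : Set} (k : Fin (suc n)) (g : Fin (suc (suc n)) → A) →
    g (inject₁ k) ≡ g (suc k) → ∀ b → g (punchIn (inject₁ k) b) ≡ g (punchIn (suc k) b)
  punchIn-adjacent-twins k g twins b with b ≟ k
  ... | yes refl = trans (cong g (punchIn-inject₁-self b)) (trans (sym twins) (cong g (sym (punchIn-suc-self b))))
  ... | no b≢k   = cong g (punchIn-inject₁≡punchIn-suc k b b≢k)

  det-adjacent-equal-cols : ∀ n (M : Matrix (suc (suc n))) (k : Fin (suc n)) →
    (∀ i → M i (inject₁ k) ≡ M i (suc k)) → det (suc (suc n)) M ≡ + 0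
  det-adjacent-equal-cols n M k twins = sumFin-cancelling-pair n k (cofactorTerm M) off-pair on-pair
    where
    open ≡-Reasoning
    minor-vanishes : ∀ n (k′ : Fin n) {j : Fin (suc (suc n))} {k : Fin (suc n)} {M : Matrix (suc (suc n))} →
      punchIn j (inject₁ k′) ≡ inject₁ k → punchIn j (suc k′) ≡ suc k →
      (∀ i → M i (inject₁ k) ≡ M i (suc k)) → det (suc n) (minor M zero j) ≡ + 0
    minor-vanishes (suc n) k′ {j} {M = M} a↦ b↦ twins = det-adjacent-equal-cols n (minor M zero j) k′
      (λ i → trans (cong (M (suc i)) a↦) (trans (twins (suc i)) (cong (M (suc i)) (sym b↦))))
    off-pair : ∀ j → j ≢ inject₁ k → j ≢ suc k → cofactorTerm M j ≡ + 0
    off-pair j j≢a j≢b with punchIn-adjacent-pair j k j≢a j≢b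
    ... | k′ , a↦ , b↦ = begin
      sign (toℕ j) * (M zero j * det (suc n) (minor M zero j))
        ≡⟨ cong (λ d → sign (toℕ j) * (M zero j * d)) (minor-vanishes n k′ {M = M} a↦ b↦ twins) ⟩
      sign (toℕ j) * (M zero j * + 0)
        ≡⟨ cong (sign (toℕ j) *_) (*-zeroʳ (M zero j)) ⟩
      sign (toℕ j) * + 0
        ≡⟨ *-zeroʳ (sign (toℕ j)) ⟩
      + 0 ∎
    cancel : ∀ σ m d → σ * (m * d) + (- + 1 * σ) * (m * d) ≡ + 0
    cancel = solve-∀
    on-pair : cofactorTerm M (inject₁ k) + cofactorTerm M (suc k) ≡ + 0
    on-pair = begin
      sign (toℕ (inject₁ k)) * (M zero (inject₁ k) * det (suc n) (minor M zero (inject₁ k))) + cofactorTerm M (suc k)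
        ≡⟨ cong₃ (λ e m d → sign e * (m * d) + cofactorTerm M (suc k)) (toℕ-inject₁ k) (twins zero)
             (det-cong (suc n) (λ a → punchIn-adjacent-twins k (M (suc a)) (twins (suc a)))) ⟩
      sign (toℕ k) * (M zero (suc k) * det (suc n) (minor M zero (suc k))) + cofactorTerm M (suc k)
        ≡⟨ cancel (sign (toℕ k)) (M zero (suc k)) _ ⟩
      + 0 ∎

  -- l′ is the position of column l once column punchIn l j has been deleted.
  punchIn-swap : ∀ {n} (l : Fin (suc (suc n))) (j : Fin (suc n)) → Σ (Fin (suc n)) λ l′ →
    (∀ b → punchIn (punchIn l j) (punchIn l′ b) ≡ punchIn l (punchIn j b)) ×
    punchIn (punchIn l j) l′ ≡ l ×
    sign (toℕ (punchIn l j)) * sign (toℕ l′) ≡ - (sign (toℕ l) * sign (toℕ j))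
  punchIn-swap zero j = zero , (λ b → refl) , refl , flip (sign (toℕ j))
    where
    flip : ∀ σ → (- + 1 * σ) * + 1 ≡ - (+ 1 * σ)
    flip = solve-∀
  punchIn-swap (suc l) zero = l , (λ b → refl) , refl , flip (sign (toℕ l))
    where
    flip : ∀ σ → + 1 * σ ≡ - ((- + 1 * σ) * + 1)
    flip = solve-∀
  punchIn-swap {suc n} (suc l) (suc j) with punchIn-swap l j
  ... | l′ , commute , l′↦l , signs = suc l′ , commute′ , cong suc l′↦l , signs′
    where
    commute′ : ∀ b → punchIn (punchIn (suc l) (suc j)) (punchIn (suc l′) b) ≡ punchIn (suc l) (punchIn (suc j) b)
    commute′ zero    = refl
    commute′ (suc b) = cong suc (commute b)
    both-flip : ∀ a b → (- + 1 * a) * (- + 1 * b) ≡ a * b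
    both-flip = solve-∀
    signs′ : (- + 1 * sign (toℕ (punchIn l j))) * (- + 1 * sign (toℕ l′)) ≡ - ((- + 1 * sign (toℕ l)) * (- + 1 * sign (toℕ j)))
    signs′ = trans (both-flip (sign (toℕ (punchIn l j))) (sign (toℕ l′)))
      (trans signs (cong -_ (sym (both-flip (sign (toℕ l)) (sign (toℕ j))))))

  det-unit-col : ∀ n (M : Matrix (suc n)) (r l : Fin (suc n)) (c : ℤ) →
    M r l ≡ c → (∀ i → i ≢ r → M i l ≡ + 0) →
    det (suc n) M ≡ sign (toℕ r ℕ.+ toℕ l) * (c * det n (minor M r l))
  det-unit-col n M zero l c pivot col≡0 = begin
    det (suc n) M
      ≡⟨ sumFin-punchIn n l (cofactorTerm M) ⟩
    cofactorTerm M l + sumFin n (λ j → cofactorTerm M (punchIn l j))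
      ≡⟨ cong₂ _+_ (cong (λ a → sign (toℕ l) * (a * det n (minor M zero l))) pivot) (others n l M col≡0) ⟩
    sign (toℕ l) * (c * det n (minor M zero l)) + + 0
      ≡⟨ +-identityʳ _ ⟩
    sign (toℕ l) * (c * det n (minor M zero l)) ∎
    where
    open ≡-Reasoning
    others : ∀ n (l : Fin (suc n)) (M : Matrix (suc n)) → (∀ i → i ≢ zero → M i l ≡ + 0) →
      sumFin n (λ j → cofactorTerm M (punchIn l j)) ≡ + 0
    others zero    l M col≡0 = refl
    others (suc n) l M col≡0 = sumFin-zero (suc n) λ j →
      let (l′ , _ , l′↦l , _) = punchIn-swap l j in begin
        sign (toℕ (punchIn l j)) * (M zero (punchIn l j) * det (suc n) (minor M zero (punchIn l j)))
          ≡⟨ cong (λ d → sign (toℕ (punchIn l j)) * (M zero (punchIn l j) * d))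
               (det-zero-col (suc n) l′ (minor M zero (punchIn l j))
                 (λ a → trans (cong (M (suc a)) l′↦l) (col≡0 (suc a) (λ ())))) ⟩
        sign (toℕ (punchIn l j)) * (M zero (punchIn l j) * + 0)
          ≡⟨ zero-right (sign (toℕ (punchIn l j))) (M zero (punchIn l j)) ⟩
        + 0 ∎
      where
      zero-right : ∀ σ m → σ * (m * + 0) ≡ + 0
      zero-right = solve-∀
  det-unit-col (suc n) M (suc r) l c pivot col≡0 = begin
    det (suc (suc n)) M
      ≡⟨ sumFin-punchIn (suc n) l (cofactorTerm M) ⟩
    cofactorTerm M l + sumFin (suc n) (λ j → cofactorTerm M (punchIn l j))
      ≡⟨ cong₂ _+_ top-vanishes (sumFin-cong (suc n) shifted) ⟩
    + 0 + sumFin (suc n) (λ j → σ * (c * cofactorTerm Mrl j))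
      ≡⟨ +-identityˡ _ ⟩
    sumFin (suc n) (λ j → σ * (c * cofactorTerm Mrl j))
      ≡⟨ sym (*-distribˡ-sumFin (suc n) σ (λ j → c * cofactorTerm Mrl j)) ⟩
    σ * sumFin (suc n) (λ j → c * cofactorTerm Mrl j)
      ≡⟨ cong (σ *_) (sym (*-distribˡ-sumFin (suc n) c (cofactorTerm Mrl))) ⟩
    σ * (c * det (suc n) Mrl) ∎
    where
    open ≡-Reasoning
    σ : ℤ
    σ = sign (suc (toℕ r ℕ.+ toℕ l))
    Mrl : Matrix (suc n)
    Mrl = minor M (suc r) l
    top-vanishes : cofactorTerm M l ≡ + 0
    top-vanishes = begin
      sign (toℕ l) * (M zero l * det (suc n) (minor M zero l))
        ≡⟨ cong (λ a → sign (toℕ l) * (a * det (suc n) (minor M zero l))) (col≡0 zero (λ ())) ⟩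
      sign (toℕ l) * (+ 0 * det (suc n) (minor M zero l))
        ≡⟨ zero-left (sign (toℕ l)) (det (suc n) (minor M zero l)) ⟩
      + 0 ∎
      where
      zero-left : ∀ σ d → σ * (+ 0 * d) ≡ + 0
      zero-left = solve-∀
    shifted : ∀ j → cofactorTerm M (punchIn l j) ≡ σ * (c * cofactorTerm Mrl j)
    shifted j with punchIn-swap l j
    ... | l′ , commute , l′↦l , signs = begin
      σₚ * (m * det (suc n) (minor M zero (punchIn l j)))
        ≡⟨ cong (λ d → σₚ * (m * d))
             (det-unit-col n (minor M zero (punchIn l j)) r l′ c (trans (cong (M (suc r)) l′↦l) pivot)
               (λ i i≢r → trans (cong (M (suc i)) l′↦l) (col≡0 (suc i) (i≢r ∘ suc-injective)))) ⟩
      σₚ * (m * (sign (toℕ r ℕ.+ toℕ l′) * (c * det n (minor (minor M zero (punchIn l j)) r l′))))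
        ≡⟨ cong₂ (λ s d → σₚ * (m * (s * (c * d)))) (sign-+ (toℕ r) (toℕ l′))
             (det-cong n (λ a b → cong (M (suc (punchIn r a))) (commute b))) ⟩
      σₚ * (m * ((sign (toℕ r) * sign (toℕ l′)) * (c * D)))
        ≡⟨ regroup σₚ (sign (toℕ l′)) m (sign (toℕ r)) c D ⟩
      (σₚ * sign (toℕ l′)) * (sign (toℕ r) * m * c * D)
        ≡⟨ cong (λ s → s * (sign (toℕ r) * m * c * D)) signs ⟩
      - (sign (toℕ l) * sign (toℕ j)) * (sign (toℕ r) * m * c * D)
        ≡⟨ regroup′ (sign (toℕ l)) (sign (toℕ j)) m (sign (toℕ r)) c D ⟩
      (- + 1 * (sign (toℕ r) * sign (toℕ l))) * (c * (sign (toℕ j) * (m * D)))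
        ≡⟨ cong (λ s → (- + 1 * s) * (c * cofactorTerm Mrl j)) (sym (sign-+ (toℕ r) (toℕ l))) ⟩
      σ * (c * cofactorTerm Mrl j) ∎
      where
      σₚ m D : ℤ
      σₚ = sign (toℕ (punchIn l j))
      m = M zero (punchIn l j)
      D = det n (minor Mrl zero j)
      regroup : ∀ p λ′ m ρ c e → p * (m * ((ρ * λ′) * (c * e))) ≡ (p * λ′) * (ρ * m * c * e)
      regroup = solve-∀
      regroup′ : ∀ λ₁ σ m ρ c e → - (λ₁ * σ) * (ρ * m * c * e) ≡ (- + 1 * (ρ * λ₁)) * (c * (σ * (m * e)))
      regroup′ = solve-∀

  idMat-diag : ∀ {n} (i : Fin n) → idMat n i i ≡ + 1
  idMat-diag i with toℕ i ≡ᵇ toℕ i in eq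
  ... | true  = refl
  ... | false = ⊥-elim (subst T eq (≡⇒≡ᵇ (toℕ i) (toℕ i) refl))

  idMat-off : ∀ {n} {i j : Fin n} → i ≢ j → idMat n i j ≡ + 0
  idMat-off {n} {i} {j} i≢j with toℕ i ≡ᵇ toℕ j in eq
  ... | false = refl
  ... | true  = ⊥-elim (i≢j (toℕ-injective (≡ᵇ⇒≡ (toℕ i) (toℕ j) (subst T (sym eq) _))))

  idMat-punchIn : ∀ {n} (r : Fin (suc n)) (i j : Fin n) → idMat (suc n) (punchIn r i) (punchIn r j) ≡ idMat n i j
  idMat-punchIn r i j with i ≟ j
  ... | yes refl = trans (idMat-diag (punchIn r i)) (sym (idMat-diag i))
  ... | no i≢j   = trans (idMat-off (i≢j ∘ punchIn-injective r i j)) (sym (idMat-off i≢j))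

  setCol : ∀ {n} → Matrix n → Fin n → (Fin n → ℤ) → Matrix n
  setCol M l v i j = if does (j ≟ l) then v i else M i j

  setCol-at : ∀ {n} (M : Matrix n) l v i → setCol M l v i l ≡ v i
  setCol-at M l v i with l ≟ l
  ... | yes _   = refl
  ... | no l≢l = ⊥-elim (l≢l refl)

  setCol-off : ∀ {n} (M : Matrix n) l v i j → j ≢ l → setCol M l v i j ≡ M i j
  setCol-off M l v i j j≢l with j ≟ l
  ... | yes j≡l = ⊥-elim (j≢l j≡l)
  ... | no _    = refl

  det-col-subtract-adjacent : ∀ n (M : Matrix (suc (suc n))) (k : Fin (suc n)) (v : Fin (suc (suc n)) → ℤ) →
    (∀ i → M i (suc k) ≡ v i + M i (inject₁ k)) → det (suc (suc n)) M ≡ det (suc (suc n)) (setCol M (suc k) v)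
  det-col-subtract-adjacent n M k v col = begin
    det (suc (suc n)) M
      ≡⟨ det-col-additive (suc (suc n)) (suc k) M (setCol M (suc k) v) (setCol M (suc k) colA)
           (λ i → trans (col i) (sym (cong₂ _+_ (setCol-at M (suc k) v i) (setCol-at M (suc k) colA i))))
           (λ i j j≢b → sym (setCol-off M (suc k) v i j j≢b))
           (λ i j j≢b → trans (setCol-off M (suc k) colA i j j≢b) (sym (setCol-off M (suc k) v i j j≢b))) ⟩
    det (suc (suc n)) (setCol M (suc k) v) + det (suc (suc n)) (setCol M (suc k) colA)
      ≡⟨ cong (_+_ (det (suc (suc n)) (setCol M (suc k) v)))
           (det-adjacent-equal-cols n (setCol M (suc k) colA) k
             (λ i → trans (setCol-off M (suc k) colA i (inject₁ k) (inject₁≢suc k)) (sym (setCol-at M (suc k) colA i)))) ⟩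
    det (suc (suc n)) (setCol M (suc k) v) + + 0
      ≡⟨ +-identityʳ _ ⟩
    det (suc (suc n)) (setCol M (suc k) v) ∎
    where
    open ≡-Reasoning
    colA : Fin (suc (suc n)) → ℤ
    colA i = M i (inject₁ k)

  det-setCol-unit : ∀ n (M : Matrix (suc n)) (r l : Fin (suc n)) (c : ℤ) →
    det (suc n) (setCol M l (λ i → c * idMat (suc n) i r)) ≡ sign (toℕ r ℕ.+ toℕ l) * (c * det n (minor M r l))
  det-setCol-unit n M r l c =
    trans (det-unit-col n (setCol M l unit) r l c
             (trans (setCol-at M l unit r) (trans (cong (c *_) (idMat-diag r)) (*-identityʳ c)))
             (λ i i≢r → trans (setCol-at M l unit i) (trans (cong (c *_) (idMat-off i≢r)) (*-zeroʳ c))))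
          (cong (λ d → sign (toℕ r ℕ.+ toℕ l) * (c * d))
             (det-cong n (λ a b → setCol-off M l unit (punchIn r a) (punchIn l b) (punchInᵢ≢i l b))))
    where
    unit : Fin (suc n) → ℤ
    unit i = c * idMat (suc n) i r

  weighted : ∀ {n} → ℤ → (Fin n → ℤ) → Matrix n → Matrix n
  weighted {n} y μ w i j = y * idMat n i j + μ i * w i j

  sign-adjacent : ∀ {n} (k : Fin n) → sign (toℕ (inject₁ k) ℕ.+ toℕ (suc k)) ≡ - + 1
  sign-adjacent k = begin
    sign (toℕ (inject₁ k) ℕ.+ suc (toℕ k)) ≡⟨ cong (λ m → sign (m ℕ.+ suc (toℕ k))) (toℕ-inject₁ k) ⟩
    sign (toℕ k ℕ.+ suc (toℕ k))           ≡⟨ cong sign (+-suc (toℕ k) (toℕ k)) ⟩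
    - + 1 * sign (toℕ k ℕ.+ toℕ k)         ≡⟨ cong (- + 1 *_) (sign-double (toℕ k)) ⟩
    - + 1                                   ∎
    where open ≡-Reasoning

  det-merged-minor : ∀ n (y : ℤ) (μ : Fin (suc (suc n)) → ℤ) (w : Matrix (suc (suc n))) (k : Fin (suc n))
    (Mt : Matrix (suc n)) → (∀ j → w (inject₁ k) j ≡ w (suc k) j) →
    (∀ q → Mt k q ≡ y * idMat (suc n) k q + (μ (inject₁ k) + μ (suc k)) * w (suc k) (punchIn (suc k) q)) →
    (∀ p q → p ≢ k → Mt p q ≡ minor (weighted y μ w) (suc k) (suc k) p q) →
    det (suc n) Mt ≡ det (suc n) (minor (weighted y μ w) (suc k) (suc k)) + det (suc n) (minor (weighted y μ w) (inject₁ k) (suc k))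
  det-merged-minor n y μ w k Mt twin-rows merged-row other-rows =
    det-row-additive (suc n) k Mt (minor M b b) (minor M a b) row-k other-rows
      (λ p q p≢k → cong (λ r → M r (punchIn b q)) (punchIn-inject₁≡punchIn-suc k p p≢k))
    where
    open ≡-Reasoning
    M : Matrix (suc (suc n))
    M = weighted y μ w
    a b : Fin (suc (suc n))
    a = inject₁ k
    b = suc k
    merge : ∀ y d μa μb z → (y * d + μa * z) + (y * + 0 + μb * z) ≡ y * d + (μa + μb) * z
    merge = solve-∀
    row-k : ∀ q → Mt k q ≡ minor M b b k q + minor M a b k q
    row-k q = sym (begin
      (y * idMat (suc (suc n)) (punchIn b k) q′ + μ (punchIn b k) * w (punchIn b k) q′)
        + (y * idMat (suc (suc n)) (punchIn a k) q′ + μ (punchIn a k) * w (punchIn a k) q′)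
        ≡⟨ cong₂ _+_
             (cong₂ (λ d r → y * d + μ r * w r q′) (idMat-punchIn b k q) (punchIn-suc-self k))
             (cong₂ (λ d r → y * d + μ r * w r q′)
               (trans (cong (λ r → idMat (suc (suc n)) r q′) (punchIn-inject₁-self k)) (idMat-off (punchInᵢ≢i b q ∘ sym)))
               (punchIn-inject₁-self k)) ⟩
      (y * idMat (suc n) k q + μ a * w a q′) + (y * + 0 + μ b * w b q′)
        ≡⟨ cong (λ z → (y * idMat (suc n) k q + μ a * z) + (y * + 0 + μ b * w b q′)) (twin-rows q′) ⟩
      (y * idMat (suc n) k q + μ a * w b q′) + (y * + 0 + μ b * w b q′)
        ≡⟨ merge y (idMat (suc n) k q) (μ a) (μ b) (w b q′) ⟩
      y * idMat (suc n) k q + (μ a + μ b) * w b q′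
        ≡⟨ sym (merged-row q) ⟩
      Mt k q ∎)
      where
      q′ : Fin (suc (suc n))
      q′ = punchIn b q

  -- Subtracting column a from its twin b leaves y(e_b − e_a) in column b; expanding along it gives
  -- y times two minors that differ only in row k, where their rows add up to the merged row.
  det-merge-twins : ∀ n (y : ℤ) (μ : Fin (suc (suc n)) → ℤ) (w : Matrix (suc (suc n))) (k : Fin (suc n))
    (Mt : Matrix (suc n)) →
    (∀ i → w i (inject₁ k) ≡ w i (suc k)) → (∀ j → w (inject₁ k) j ≡ w (suc k) j) →
    (∀ q → Mt k q ≡ y * idMat (suc n) k q + (μ (inject₁ k) + μ (suc k)) * w (suc k) (punchIn (suc k) q)) →
    (∀ p q → p ≢ k → Mt p q ≡ minor (weighted y μ w) (suc k) (suc k) p q) →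
    det (suc (suc n)) (weighted y μ w) ≡ y * det (suc n) Mt
  det-merge-twins n y μ w k Mt twin-cols twin-rows merged-row other-rows = begin
    det (suc (suc n)) M
      ≡⟨ det-col-subtract-adjacent n M k v col-b ⟩
    det (suc (suc n)) (setCol M b v)
      ≡⟨ det-col-additive (suc (suc n)) b (setCol M b v) (setCol M b eb) (setCol M b ea)
           (λ i → trans (setCol-at M b v i) (sym (cong₂ _+_ (setCol-at M b eb i) (setCol-at M b ea i))))
           (λ i j j≢b → trans (setCol-off M b v i j j≢b) (sym (setCol-off M b eb i j j≢b)))
           (λ i j j≢b → trans (setCol-off M b ea i j j≢b) (sym (setCol-off M b eb i j j≢b))) ⟩
    det (suc (suc n)) (setCol M b eb) + det (suc (suc n)) (setCol M b ea)
      ≡⟨ cong₂ _+_ (det-setCol-unit (suc n) M b b y) (det-setCol-unit (suc n) M a b (- y)) ⟩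
    sign (toℕ b ℕ.+ toℕ b) * (y * det (suc n) Nbb) + sign (toℕ a ℕ.+ toℕ b) * (- y * det (suc n) Nab)
      ≡⟨ cong₂ (λ s s′ → s * (y * det (suc n) Nbb) + s′ * (- y * det (suc n) Nab)) (sign-double (toℕ b)) (sign-adjacent k) ⟩
    + 1 * (y * det (suc n) Nbb) + - + 1 * (- y * det (suc n) Nab)
      ≡⟨ collect y (det (suc n) Nbb) (det (suc n) Nab) ⟩
    y * (det (suc n) Nbb + det (suc n) Nab)
      ≡⟨ cong (y *_) (sym (det-merged-minor n y μ w k Mt twin-rows merged-row other-rows)) ⟩
    y * det (suc n) Mt ∎
    where
    open ≡-Reasoning
    M : Matrix (suc (suc n))
    M = weighted y μ w
    a b : Fin (suc (suc n))
    a = inject₁ k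
    b = suc k
    eb ea v : Fin (suc (suc n)) → ℤ
    eb i = y * idMat (suc (suc n)) i b
    ea i = - y * idMat (suc (suc n)) i a
    v i = eb i + ea i
    Nbb Nab : Matrix (suc n)
    Nbb = minor M b b
    Nab = minor M a b
    shift : ∀ y d e m z → y * d + m * z ≡ (y * d + - y * e) + (y * e + m * z)
    shift = solve-∀
    col-b : ∀ i → M i b ≡ v i + M i a
    col-b i = trans (cong (λ z → eb i + μ i * z) (sym (twin-cols i)))
                    (shift y (idMat (suc (suc n)) i b) (idMat (suc (suc n)) i a) (μ i) (w i a))
    collect : ∀ y d e → + 1 * (y * d) + - + 1 * (- y * e) ≡ y * (d + e)
    collect = solve-∀

module Labelling where
  open import Defs
  open Determinant
  open import Data.Bool using (Bool; true; false; if_then_else_)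
  open import Data.Empty using (⊥-elim)
  open import Data.Fin using (Fin; zero; suc; toℕ; punchIn; inject₁; fromℕ<; _≟_)
  open import Data.Fin.Properties using (toℕ-inject₁; toℕ-fromℕ<)
  open import Data.Integer using (ℤ; +_; -_; _+_; _*_; _^_)
  open import Data.Integer.Properties using (*-identityˡ) renaming (*-assoc to *-assocℤ)
  open import Data.List using (List; []; _∷_; length; replicate)
  open import Data.Nat as ℕ using (ℕ; zero; suc; s≤s)
  open import Data.Nat.Properties using (≤-trans; ≤-reflexive; m≤n+m; +-identityʳ; +-assoc)
  open import Data.Product using (_×_; _,_; proj₁; proj₂)
  open import Function using (_∘_)
  open import Relation.Binary.PropositionalEquality
  open import Relation.Nullary using (yes; no)

  data Outer : Set where
    pendant₁ pendant₂ far : Outer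

  data Role : Set where
    v₁ v₂ v₃ v₄ : Role
    outer      : Outer → Role

  edge : Role → Role → Bool
  edge (outer _)          (outer _)          = false
  edge v₁                 v₂                 = true
  edge v₂                 v₁                 = true
  edge v₂                 v₃                 = true
  edge v₃                 v₂                 = true
  edge v₃                 v₄                 = true
  edge v₄                 v₃                 = true
  edge v₄                 v₁                 = true
  edge v₁                 v₄                 = true
  edge v₁                 (outer pendant₁)   = true
  edge (outer pendant₁)   v₁                 = true
  edge v₂                 (outer pendant₂)   = true
  edge (outer pendant₂)   v₂                 = true
  edge _                  _                  = false

  W : Role → Role → ℤ
  W r r′ = if edge r r′ then + 1 else - + 1

  Label : Set
  Label = Role × ℕ

  role : Label → Role
  role = proj₁

  weight : Label → ℕ
  weight = proj₂

  Seq : Set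
  Seq = ℕ → Label

  infixr 5 _∷ˢ_ _++ˢ_

  _∷ˢ_ : Label → Seq → Seq
  (x ∷ˢ g) zero    = x
  (x ∷ˢ g) (suc m) = g m

  _++ˢ_ : List Label → Seq → Seq
  []       ++ˢ g = g
  (x ∷ xs) ++ˢ g = x ∷ˢ (xs ++ˢ g)

  labelMatrix : ℤ → (N : ℕ) → Seq → Matrix N
  labelMatrix y N g = weighted y (λ i → + weight (g (toℕ i))) (λ i j → W (role (g (toℕ i))) (role (g (toℕ j))))

  -- Kept opaque so that comparing two label determinants compares the labellings instead of
  -- unfolding the cofactor expansion.
  opaque
    labelDet : ℤ → (N : ℕ) → Seq → ℤ
    labelDet y N g = det N (labelMatrix y N g)

  opaque
    unfolding labelDet

    labelDet-cong : ∀ y N {g h : Seq} → (∀ m → g m ≡ h m) → labelDet y N g ≡ labelDet y N h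
    labelDet-cong y N g≗h = det-cong N λ i j →
      cong₂ (λ u v → y * idMat N i j + + weight u * W (role u) (role v)) (g≗h (toℕ i)) (g≗h (toℕ j))

  data MergedAt : ℕ → Seq → Seq → Set where
    here  : ∀ r m m′ g → MergedAt 0 ((r , m) ∷ˢ (r , m′) ∷ˢ g) ((r , m ℕ.+ m′) ∷ˢ g)
    there : ∀ x {a g g′} → MergedAt a g g′ → MergedAt (suc a) (x ∷ˢ g) (x ∷ˢ g′)

  MergedAt-++ : ∀ xs {a g g′} → MergedAt a g g′ → MergedAt (length xs ℕ.+ a) (xs ++ˢ g) (xs ++ˢ g′)
  MergedAt-++ []       merged = merged
  MergedAt-++ (x ∷ xs) merged = there x (MergedAt-++ xs merged)

  MergedAt-roles : ∀ {a g g′} → MergedAt a g g′ → role (g a) ≡ role (g (suc a))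
  MergedAt-roles (here r m m′ g)    = refl
  MergedAt-roles (there x merged) = MergedAt-roles merged

  MergedAt-merged : ∀ {a g g′} → MergedAt a g g′ → g′ a ≡ (role (g (suc a)) , weight (g a) ℕ.+ weight (g (suc a)))
  MergedAt-merged (here r m m′ g)    = refl
  MergedAt-merged (there x merged) = MergedAt-merged merged

  MergedAt-skip : ∀ {n} (k : Fin (suc n)) {g g′} → MergedAt (toℕ k) g g′ →
    ∀ q → q ≢ k → g′ (toℕ q) ≡ g (toℕ (punchIn (suc k) q))
  MergedAt-skip zero              (here r m m′ g)   zero    q≢k = ⊥-elim (q≢k refl)
  MergedAt-skip zero              (here r m m′ g)   (suc q) q≢k = refl
  MergedAt-skip {suc n} (suc k) (there x merged) zero    q≢k = refl
  MergedAt-skip {suc n} (suc k) (there x merged) (suc q) q≢k = MergedAt-skip k merged q (q≢k ∘ cong suc)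

  opaque
    unfolding labelDet

    labelDet-merge : ∀ n (y : ℤ) {a g g′} → a ℕ.< suc n → MergedAt a g g′ →
      labelDet y (suc (suc n)) g ≡ y * labelDet y (suc n) g′
    labelDet-merge n y {a} {g} {g′} a<1+n merged =
      det-merge-twins n y μ w k (labelMatrix y (suc n) g′) twin-cols twin-rows merged-row other-rows
      where
      k : Fin (suc n)
      k = fromℕ< a<1+n
      mergedₖ : MergedAt (toℕ k) g g′
      mergedₖ = subst (λ b → MergedAt b g g′) (sym (toℕ-fromℕ< a<1+n)) merged
      μ : Fin (suc (suc n)) → ℤ
      μ i = + weight (g (toℕ i))
      ρ : Fin (suc (suc n)) → Role
      ρ i = role (g (toℕ i))
      w : Matrix (suc (suc n))
      w i j = W (ρ i) (ρ j)
      at-k : ∀ {A : Set} (f : Label → A) → f (g (toℕ (inject₁ k))) ≡ f (g (toℕ k))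
      at-k f = cong (f ∘ g) (toℕ-inject₁ k)
      twins : ρ (inject₁ k) ≡ ρ (suc k)
      twins = trans (at-k role) (MergedAt-roles mergedₖ)
      twin-cols : ∀ i → w i (inject₁ k) ≡ w i (suc k)
      twin-cols i = cong (W (ρ i)) twins
      twin-rows : ∀ j → w (inject₁ k) j ≡ w (suc k) j
      twin-rows j = cong (λ r → W r (ρ j)) twins
      role′ : ∀ q → role (g′ (toℕ q)) ≡ ρ (punchIn (suc k) q)
      role′ q with q ≟ k
      ... | yes refl = trans (cong role (MergedAt-merged mergedₖ)) (trans (sym twins) (cong ρ (sym (punchIn-suc-self q))))
      ... | no q≢k   = cong role (MergedAt-skip k mergedₖ q q≢k)
      merged-row : ∀ q → labelMatrix y (suc n) g′ k q ≡ y * idMat (suc n) k q + (μ (inject₁ k) + μ (suc k)) * w (suc k) (punchIn (suc k) q)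
      merged-row q = cong₃ (λ u r r′ → y * idMat (suc n) k q + u * W r r′)
        (trans (cong (+_ ∘ weight) (MergedAt-merged mergedₖ)) (cong (λ u → u + μ (suc k)) (sym (at-k (+_ ∘ weight)))))
        (cong role (MergedAt-merged mergedₖ))
        (role′ q)
      other-rows : ∀ p q → p ≢ k → labelMatrix y (suc n) g′ p q ≡ minor (weighted y μ w) (suc k) (suc k) p q
      other-rows p q p≢k = cong₃ (λ d u r → y * d + + weight u * W (role u) r)
        (sym (idMat-punchIn (suc k) p q)) (MergedAt-skip k mergedₖ p p≢k) (role′ q)

  labelDet-collapse-run : ∀ (y : ℤ) (xs : List Label) (r : Role) (m p : ℕ) (g : Seq) {N} (M : ℕ) →
    N ≡ suc (p ℕ.+ M) → length xs ℕ.≤ M →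
    labelDet y N (xs ++ˢ (r , m) ∷ˢ replicate p (r , 1) ++ˢ g)
      ≡ y ^ p * labelDet y (suc M) (xs ++ˢ (r , m ℕ.+ p) ∷ˢ g)
  labelDet-collapse-run y xs r m zero g M refl len≤M = sym (begin
    + 1 * labelDet y (suc M) (xs ++ˢ (r , m ℕ.+ 0) ∷ˢ g)
      ≡⟨ *-identityˡ _ ⟩
    labelDet y (suc M) (xs ++ˢ (r , m ℕ.+ 0) ∷ˢ g)
      ≡⟨ cong (λ w → labelDet y (suc M) (xs ++ˢ (r , w) ∷ˢ g)) (+-identityʳ m) ⟩
    labelDet y (suc M) (xs ++ˢ (r , m) ∷ˢ g) ∎)
    where open ≡-Reasoning
  labelDet-collapse-run y xs r m (suc p) g M refl len≤M = begin
    labelDet y (suc (suc (p ℕ.+ M))) (xs ++ˢ (r , m) ∷ˢ (r , 1) ∷ˢ replicate p (r , 1) ++ˢ g)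
      ≡⟨ labelDet-merge (p ℕ.+ M) y (s≤s position≤) (MergedAt-++ xs (here r m 1 _)) ⟩
    y * labelDet y (suc (p ℕ.+ M)) (xs ++ˢ (r , m ℕ.+ 1) ∷ˢ replicate p (r , 1) ++ˢ g)
      ≡⟨ cong (y *_) (labelDet-collapse-run y xs r (m ℕ.+ 1) p g M refl len≤M) ⟩
    y * (y ^ p * labelDet y (suc M) (xs ++ˢ (r , m ℕ.+ 1 ℕ.+ p) ∷ˢ g))
      ≡⟨ sym (*-assocℤ y (y ^ p) _) ⟩
    y ^ suc p * labelDet y (suc M) (xs ++ˢ (r , m ℕ.+ 1 ℕ.+ p) ∷ˢ g)
      ≡⟨ cong (λ w → y ^ suc p * labelDet y (suc M) (xs ++ˢ (r , w) ∷ˢ g)) (+-assoc m 1 p) ⟩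
    y ^ suc p * labelDet y (suc M) (xs ++ˢ (r , m ℕ.+ suc p) ∷ˢ g) ∎
    where
    open ≡-Reasoning
    position≤ : length xs ℕ.+ 0 ℕ.≤ p ℕ.+ M
    position≤ = ≤-trans (≤-reflexive (+-identityʳ (length xs))) (≤-trans len≤M (m≤n+m M p))

module Quotient where
  open import Defs
  open Determinant
  open Labelling
  open import Data.Fin using (Fin; zero; suc; toℕ; punchIn; #_)
  open import Data.Fin.Properties using (toℕ<n)
  open import Data.Integer using (ℤ; +_; _+_; _*_)
  open import Data.Integer.Tactic.RingSolver using (ring)
  open import Data.List using (List; []; _∷_)
  open import Data.Nat as ℕ using (ℕ; zero; suc; s≤s; z≤n; _∸_)
  open import Data.Nat.Properties using (≤-trans; ≤-refl)
  open import Data.Product using (_,_)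
  open import Data.Vec using (Vec; []; _∷_)
  open import Function using (_∘_)
  open import Relation.Binary.PropositionalEquality
  open import Tactic.RingSolver.NonReflective ring using (Expr; Κ; Ι; _⊕_; _⊗_; ⊝_; module Ops)
  open import Tactic.RingSolver.Core.Polynomial.Semantics Ops.homo using () renaming (⟦_⟧ to ⟦_⟧ₚ)

  ⟦_⟧ : ∀ {v} → Expr ℤ v → Vec ℤ v → ℤ
  ⟦ e ⟧ = Ops.⟦ e ⟧

  normalForms-equal : ∀ {v} (e₁ e₂ : Expr ℤ v) → Ops.norm e₁ ≡ Ops.norm e₂ → ∀ ρ → ⟦ e₁ ⟧ ρ ≡ ⟦ e₂ ⟧ ρ
  normalForms-equal e₁ e₂ norm≡ ρ = Ops.prove ρ e₁ e₂ (cong (λ p → ⟦ p ⟧ₚ ρ) norm≡)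

  sumExpr : ∀ {v} (n : ℕ) → (Fin n → Expr ℤ v) → Expr ℤ v
  sumExpr zero    f = Κ (+ 0)
  sumExpr (suc n) f = f zero ⊕ sumExpr n (λ j → f (suc j))

  detExpr : ∀ {v} (n : ℕ) → (Fin n → Fin n → Expr ℤ v) → Expr ℤ v
  detExpr zero    M = Κ (+ 1)
  detExpr (suc n) M = sumExpr (suc n) λ j → Κ (sign (toℕ j)) ⊗ (M zero j ⊗ detExpr n (λ a b → M (suc a) (punchIn j b)))

  ⟦sumExpr⟧ : ∀ {v} n (f : Fin n → Expr ℤ v) ρ → ⟦ sumExpr n f ⟧ ρ ≡ sumFin n (λ j → ⟦ f j ⟧ ρ)
  ⟦sumExpr⟧ zero    f ρ = refl
  ⟦sumExpr⟧ (suc n) f ρ = cong (_+_ (⟦ f zero ⟧ ρ)) (⟦sumExpr⟧ n (λ j → f (suc j)) ρ)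

  ⟦detExpr⟧ : ∀ {v} n (M : Fin n → Fin n → Expr ℤ v) ρ → ⟦ detExpr n M ⟧ ρ ≡ det n (λ i j → ⟦ M i j ⟧ ρ)
  ⟦detExpr⟧ zero    M ρ = refl
  ⟦detExpr⟧ (suc n) M ρ = trans (⟦sumExpr⟧ (suc n) term ρ) (sumFin-cong (suc n) λ j →
    cong (λ d → sign (toℕ j) * (⟦ M zero j ⟧ ρ * d)) (⟦detExpr⟧ n (λ a b → M (suc a) (punchIn j b)) ρ))
    where
    term : Fin (suc n) → Expr ℤ _
    term j = Κ (sign (toℕ j)) ⊗ (M zero j ⊗ detExpr n (λ a b → M (suc a) (punchIn j b)))

  infixl 6 _⊖_
  infixr 8 _^ᵉ_

  _⊖_ : ∀ {v} → Expr ℤ v → Expr ℤ v → Expr ℤ v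
  a ⊖ b = a ⊕ ⊝ b

  _^ᵉ_ : ∀ {v} → Expr ℤ v → ℕ → Expr ℤ v
  e ^ᵉ zero  = Κ (+ 1)
  e ^ᵉ suc k = e ⊗ e ^ᵉ k

  -- The polynomial of septic, written so that evaluating it unfolds to exactly the expression in septic.
  septicExpr : ∀ {v} (S T N K U x : Expr ℤ v) → Expr ℤ v
  septicExpr S T N K U x =
      x ^ᵉ 7
    ⊕ (c 7 ⊖ N) ⊗ x ^ᵉ 6
    ⊕ (c 21 ⊖ c 6 ⊗ N) ⊗ x ^ᵉ 5
    ⊕ (c 12 ⊗ K ⊖ c 15 ⊗ N ⊕ c 4 ⊗ K ⊗ U ⊕ c 8 ⊗ st ⊖ c 13) ⊗ x ^ᵉ 4
    ⊕ (c 48 ⊗ K ⊖ c 20 ⊗ N ⊕ c 16 ⊗ K ⊗ U ⊕ c 32 ⊗ st ⊖ c 157) ⊗ x ^ᵉ 3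
    ⊕ (c 113 ⊗ N ⊖ c 56 ⊗ K ⊖ c 8 ⊗ K ⊗ U ⊖ c 16 ⊗ st ⊗ (U ⊖ c 1) ⊖ c 267) ⊗ x ^ᵉ 2
    ⊕ (c 250 ⊗ N ⊖ c 208 ⊗ K ⊖ c 48 ⊗ K ⊗ U ⊖ c 32 ⊗ st ⊗ (U ⊕ c 1) ⊖ c 185) ⊗ x
    ⊕ (c 127 ⊗ N ⊖ c 116 ⊗ K ⊖ c 28 ⊗ K ⊗ U ⊕ c 24 ⊗ st ⊗ (c 2 ⊗ U ⊖ c 1) ⊖ c 47)
    where
    c : ℕ → Expr ℤ _
    c k = Κ (+ k)
    st : Expr ℤ _
    st = S ⊗ T

  septicℤ : (S T N K U x : ℤ) → ℤ
  septicℤ S T N K U x = ⟦ septicExpr (Ι (# 0)) (Ι (# 1)) (Ι (# 2)) (Ι (# 3)) (Ι (# 4)) (Ι (# 5)) ⟧ (S ∷ T ∷ N ∷ K ∷ U ∷ x ∷ [])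

  septic≡septicℤ : ∀ s t n x →
    septic s t n x ≡ septicℤ (+ s) (+ t) (+ n) (+ (s ℕ.+ t ℕ.+ 4)) (+ (n ∸ (s ℕ.+ t ℕ.+ 4))) x
  septic≡septicℤ s t n x = refl

  cycle : List Label
  cycle = (v₁ , 1) ∷ (v₂ , 1) ∷ (v₃ , 1) ∷ (v₄ , 1) ∷ []

  far₁ : Label
  far₁ = (outer far , 1)

  quotientSeq : ℕ → ℕ → Seq → Seq
  quotientSeq s t h = cycle ++ˢ (outer pendant₁ , s) ∷ˢ (outer pendant₂ , t) ∷ˢ h

  quotientRole : ℕ → Role
  quotientRole 0 = v₁
  quotientRole 1 = v₂
  quotientRole 2 = v₃
  quotientRole 3 = v₄
  quotientRole 4 = outer pendant₁
  quotientRole 5 = outer pendant₂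
  quotientRole _ = outer far

  -- Variables of the quotient matrix: Ι 0 = x, Ι 1 = s, Ι 2 = t, Ι 3 = u.
  quotientWeight : ℕ → Expr ℤ 4
  quotientWeight 4 = Ι (# 1)
  quotientWeight 5 = Ι (# 2)
  quotientWeight 6 = Ι (# 3)
  quotientWeight _ = Κ (+ 1)

  quotientExpr : ∀ {n} → Fin n → Fin n → Expr ℤ 4
  quotientExpr {n} i j =
    (Ι (# 0) ⊕ Κ (+ 1)) ⊗ Κ (idMat n i j) ⊕ quotientWeight (toℕ i) ⊗ Κ (W (quotientRole (toℕ i)) (quotientRole (toℕ j)))

  quotientSeq-role : ∀ s t h u → h 0 ≡ (outer far , u) → ∀ m → m ℕ.< 7 → role (quotientSeq s t h m) ≡ quotientRole m
  quotientSeq-role s t h u h₀ 0 _ = refl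
  quotientSeq-role s t h u h₀ 1 _ = refl
  quotientSeq-role s t h u h₀ 2 _ = refl
  quotientSeq-role s t h u h₀ 3 _ = refl
  quotientSeq-role s t h u h₀ 4 _ = refl
  quotientSeq-role s t h u h₀ 5 _ = refl
  quotientSeq-role s t h u h₀ 6 _ = cong role h₀
  quotientSeq-role s t h u h₀ (suc (suc (suc (suc (suc (suc (suc m))))))) (s≤s (s≤s (s≤s (s≤s (s≤s (s≤s (s≤s ())))))))

  quotientSeq-weight : ∀ x s t h u → h 0 ≡ (outer far , u) → ∀ m → m ℕ.< 7 →
    + weight (quotientSeq s t h m) ≡ ⟦ quotientWeight m ⟧ (x ∷ + s ∷ + t ∷ + u ∷ [])
  quotientSeq-weight x s t h u h₀ 0 _ = refl
  quotientSeq-weight x s t h u h₀ 1 _ = refl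
  quotientSeq-weight x s t h u h₀ 2 _ = refl
  quotientSeq-weight x s t h u h₀ 3 _ = refl
  quotientSeq-weight x s t h u h₀ 4 _ = refl
  quotientSeq-weight x s t h u h₀ 5 _ = refl
  quotientSeq-weight x s t h u h₀ 6 _ = cong (+_ ∘ weight) h₀
  quotientSeq-weight x s t h u h₀ (suc (suc (suc (suc (suc (suc (suc m))))))) (s≤s (s≤s (s≤s (s≤s (s≤s (s≤s (s≤s ())))))))

  labelMatrix-quotientSeq : ∀ {n} → n ℕ.≤ 7 → ∀ x s t h u → h 0 ≡ (outer far , u) → ∀ i j →
    labelMatrix (x + + 1) n (quotientSeq s t h) i j ≡ ⟦ quotientExpr i j ⟧ (x ∷ + s ∷ + t ∷ + u ∷ [])
  labelMatrix-quotientSeq {n} n≤7 x s t h u h₀ i j =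
    cong₃ (λ μ r r′ → (x + + 1) * idMat n i j + μ * W r r′)
      (quotientSeq-weight x s t h u h₀ (toℕ i) (bound i))
      (quotientSeq-role s t h u h₀ (toℕ i) (bound i))
      (quotientSeq-role s t h u h₀ (toℕ j) (bound j))
    where
    bound : (k : Fin n) → toℕ k ℕ.< 7
    bound k = ≤-trans (toℕ<n k) n≤7

  xᵉ sᵉ tᵉ uᵉ : Expr ℤ 4
  xᵉ = Ι (# 0)
  sᵉ = Ι (# 1)
  tᵉ = Ι (# 2)
  uᵉ = Ι (# 3)

  septic₇ᵉ : Expr ℤ 4
  septic₇ᵉ = septicExpr sᵉ tᵉ (sᵉ ⊕ tᵉ ⊕ Κ (+ 4) ⊕ uᵉ) (sᵉ ⊕ tᵉ ⊕ Κ (+ 4)) uᵉ xᵉ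

  septic₆ᵉ : Expr ℤ 4
  septic₆ᵉ = septicExpr sᵉ tᵉ (sᵉ ⊕ tᵉ ⊕ Κ (+ 4) ⊕ Κ (+ 0)) (sᵉ ⊕ tᵉ ⊕ Κ (+ 4)) (Κ (+ 0)) xᵉ

  quotient₇-normalForm : Ops.norm (detExpr 7 quotientExpr) ≡ Ops.norm septic₇ᵉ
  quotient₇-normalForm = refl

  quotient₆-normalForm : Ops.norm ((xᵉ ⊕ Κ (+ 1)) ⊗ detExpr 6 quotientExpr) ≡ Ops.norm septic₆ᵉ
  quotient₆-normalForm = refl

  opaque
    unfolding labelDet

    labelDet-quotient₇ : ∀ x s t u →
      labelDet (x + + 1) 7 (quotientSeq s t ((outer far , u) ∷ˢ λ _ → far₁))
        ≡ septicℤ (+ s) (+ t) (+ s + + t + + 4 + + u) (+ s + + t + + 4) (+ u) x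
    labelDet-quotient₇ x s t u =
      trans (det-cong 7 {labelMatrix (x + + 1) 7 (quotientSeq s t ((outer far , u) ∷ˢ λ _ → far₁))}
                        {λ i j → ⟦ quotientExpr i j ⟧ ρ}
                        (labelMatrix-quotientSeq ≤-refl x s t ((outer far , u) ∷ˢ λ _ → far₁) u refl))
      (trans (sym (⟦detExpr⟧ 7 quotientExpr ρ))
             (normalForms-equal (detExpr 7 quotientExpr) septic₇ᵉ quotient₇-normalForm ρ))
      where
      ρ : Vec ℤ 4
      ρ = x ∷ + s ∷ + t ∷ + u ∷ []

    -- The far weight Ι 3 is set to 1 here only to match the tail; a 6 × 6 matrix never reads it.
    labelDet-quotient₆ : ∀ x s t →
      (x + + 1) * labelDet (x + + 1) 6 (quotientSeq s t λ _ → far₁)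
        ≡ septicℤ (+ s) (+ t) (+ s + + t + + 4 + + 0) (+ s + + t + + 4) (+ 0) x
    labelDet-quotient₆ x s t =
      trans (cong ((x + + 1) *_)
        (trans (det-cong 6 {labelMatrix (x + + 1) 6 (quotientSeq s t λ _ → far₁)}
                           {λ i j → ⟦ quotientExpr i j ⟧ ρ}
                           (labelMatrix-quotientSeq (s≤s (s≤s (s≤s (s≤s (s≤s (s≤s z≤n)))))) x s t (λ _ → far₁) 1 refl))
               (sym (⟦detExpr⟧ 6 quotientExpr ρ))))
      (normalForms-equal ((xᵉ ⊕ Κ (+ 1)) ⊗ detExpr 6 quotientExpr) septic₆ᵉ quotient₆-normalForm ρ)
      where
      ρ : Vec ℤ 4
      ρ = x ∷ + s ∷ + t ∷ + 1 ∷ []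

module SignedGraph where
  open import Defs
  open Determinant
  open Labelling
  open Quotient
  open import Data.Bool using (Bool; true; false; not; if_then_else_; T)
  open import Data.Fin using (Fin; toℕ)
  open import Data.Integer using (ℤ; +_; -_; _+_; _-_; _*_; _^_)
  open import Data.Integer.Properties using (^-distribˡ-+-*; *-assoc)
  import Data.Integer.Tactic.RingSolver as ℤ-Solver
  open import Data.List using (List; []; _∷_; _++_; replicate)
  open import Data.Nat as ℕ using (ℕ; zero; suc; _<ᵇ_; _≡ᵇ_)
  open import Data.Nat.Properties using (≡ᵇ⇒≡; ≤-refl; ≤-trans; m≤n+m; m≤m+n)
  open import Data.Nat.Tactic.RingSolver using (solve-∀)
  open import Data.Product using (_,_)
  open import Relation.Binary.PropositionalEquality

  signedLabels : ℕ → ℕ → Seq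
  signedLabels s t = cycle ++ˢ replicate s (outer pendant₁ , 1) ++ˢ replicate t (outer pendant₂ , 1) ++ˢ λ _ → far₁

  outerRole : ℕ → ℕ → ℕ → Outer
  outerRole s t b = if b <ᵇ s then pendant₁ else if b <ᵇ s ℕ.+ t then pendant₂ else far

  vertexRole : ℕ → ℕ → ℕ → Role
  vertexRole s t 0 = v₁
  vertexRole s t 1 = v₂
  vertexRole s t 2 = v₃
  vertexRole s t 3 = v₄
  vertexRole s t (suc (suc (suc (suc b)))) = outer (outerRole s t b)

  signedLabels-role : ∀ s t m → role (signedLabels s t m) ≡ vertexRole s t m
  signedLabels-role s t 0 = refl
  signedLabels-role s t 1 = refl
  signedLabels-role s t 2 = refl
  signedLabels-role s t 3 = refl
  signedLabels-role s t (suc (suc (suc (suc b)))) = outer-role s b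
    where
    outer-role : ∀ s b → role ((replicate s (outer pendant₁ , 1) ++ˢ replicate t (outer pendant₂ , 1) ++ˢ λ _ → far₁) b)
                          ≡ outer (outerRole s t b)
    outer-role zero b = pendants₂ t b
      where
      pendants₂ : ∀ t b → role ((replicate t (outer pendant₂ , 1) ++ˢ λ _ → far₁) b) ≡ outer (outerRole 0 t b)
      pendants₂ zero    b       = refl
      pendants₂ (suc t) zero    = refl
      pendants₂ (suc t) (suc b) = pendants₂ t b
    outer-role (suc s) zero    = refl
    outer-role (suc s) (suc b) = outer-role s b

  signedLabels-weight : ∀ s t m → weight (signedLabels s t m) ≡ 1
  signedLabels-weight s t 0 = refl
  signedLabels-weight s t 1 = refl
  signedLabels-weight s t 2 = refl
  signedLabels-weight s t 3 = refl
  signedLabels-weight s t (suc (suc (suc (suc b)))) = ones s (replicate t (outer pendant₂ , 1) ++ˢ λ _ → far₁) (ones t _ (λ _ → refl)) b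
    where
    ones : ∀ k {r} g → (∀ m → weight (g m) ≡ 1) → ∀ m → weight ((replicate k (r , 1) ++ˢ g) m) ≡ 1
    ones zero    g g≡1 m       = g≡1 m
    ones (suc k) g g≡1 zero    = refl
    ones (suc k) g g≡1 (suc m) = ones k g g≡1 m

  <ᵇ-suc-flip : ∀ s b → (s <ᵇ suc b) ≡ not (b <ᵇ s)
  <ᵇ-suc-flip zero    b       = refl
  <ᵇ-suc-flip (suc s) zero    = refl
  <ᵇ-suc-flip (suc s) (suc b) = <ᵇ-suc-flip s b

  QEdge-vertexRole : ∀ s t m m′ → QEdge s t m m′ ≡ edge (vertexRole s t m) (vertexRole s t m′)
  QEdge-vertexRole s t 0 0 = refl
  QEdge-vertexRole s t 0 1 = refl
  QEdge-vertexRole s t 0 2 = refl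
  QEdge-vertexRole s t 0 3 = refl
  QEdge-vertexRole s t 1 0 = refl
  QEdge-vertexRole s t 1 1 = refl
  QEdge-vertexRole s t 1 2 = refl
  QEdge-vertexRole s t 1 3 = refl
  QEdge-vertexRole s t 2 0 = refl
  QEdge-vertexRole s t 2 1 = refl
  QEdge-vertexRole s t 2 2 = refl
  QEdge-vertexRole s t 2 3 = refl
  QEdge-vertexRole s t 3 0 = refl
  QEdge-vertexRole s t 3 1 = refl
  QEdge-vertexRole s t 3 2 = refl
  QEdge-vertexRole s t 3 3 = refl
  QEdge-vertexRole s t 2 (suc (suc (suc (suc b)))) = refl
  QEdge-vertexRole s t 3 (suc (suc (suc (suc b)))) = refl
  QEdge-vertexRole s t (suc (suc (suc (suc b)))) 2 = refl
  QEdge-vertexRole s t (suc (suc (suc (suc b)))) 3 = refl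
  QEdge-vertexRole s t (suc (suc (suc (suc b)))) (suc (suc (suc (suc b′)))) = refl
  QEdge-vertexRole s t 0 (suc (suc (suc (suc b)))) with b <ᵇ s | b <ᵇ s ℕ.+ t
  ... | true  | _     = refl
  ... | false | true  = refl
  ... | false | false = refl
  QEdge-vertexRole s t (suc (suc (suc (suc b)))) 0 with b <ᵇ s | b <ᵇ s ℕ.+ t
  ... | true  | _     = refl
  ... | false | true  = refl
  ... | false | false = refl
  -- Membership in the range of pendants at v₂ tests 4 + s ≤ᵇ 4 + b, which computes to s <ᵇ suc b.
  QEdge-vertexRole s t 1 (suc (suc (suc (suc b)))) rewrite <ᵇ-suc-flip s b with b <ᵇ s | b <ᵇ s ℕ.+ t
  ... | true  | _     = refl
  ... | false | true  = refl
  ... | false | false = refl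
  QEdge-vertexRole s t (suc (suc (suc (suc b)))) 1 rewrite <ᵇ-suc-flip s b with b <ᵇ s | b <ᵇ s ℕ.+ t
  ... | true  | _     = refl
  ... | false | true  = refl
  ... | false | false = refl

  edge-irreflexive : ∀ r → edge r r ≡ false
  edge-irreflexive v₁        = refl
  edge-irreflexive v₂        = refl
  edge-irreflexive v₃        = refl
  edge-irreflexive v₄        = refl
  edge-irreflexive (outer _) = refl

  QEdge-irreflexive : ∀ s t {m m′} → (m ≡ᵇ m′) ≡ true → QEdge s t m m′ ≡ false
  QEdge-irreflexive s t {m} {m′} m≡ᵇm′ with ≡ᵇ⇒≡ m m′ (subst T (sym m≡ᵇm′) _)
  ... | refl = trans (QEdge-vertexRole s t m m) (edge-irreflexive (vertexRole s t m))

  diagonal-shift : ∀ x (B Q : Bool) → (B ≡ true → Q ≡ false) →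
    x * (if B then + 1 else + 0) - (if B then + 0 else (if Q then - + 1 else + 1))
      ≡ (x + + 1) * (if B then + 1 else + 0) + + 1 * (if Q then + 1 else - + 1)
  diagonal-shift x true  Q no-loop rewrite no-loop refl = diagonal x
    where
    diagonal : ∀ x → x * + 1 - + 0 ≡ (x + + 1) * + 1 + + 1 * - + 1
    diagonal = ℤ-Solver.solve-∀
  diagonal-shift x false true  _ = negative x
    where
    negative : ∀ x → x * + 0 - - + 1 ≡ (x + + 1) * + 0 + + 1 * + 1
    negative = ℤ-Solver.solve-∀
  diagonal-shift x false false _ = positive x
    where
    positive : ∀ x → x * + 0 - + 1 ≡ (x + + 1) * + 0 + + 1 * - + 1
    positive = ℤ-Solver.solve-∀

  charMatrix≡labelMatrix : ∀ s t n x (i j : Fin n) →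
    x * idMat n i j - signedAdj s t n i j ≡ labelMatrix (x + + 1) n (signedLabels s t) i j
  charMatrix≡labelMatrix s t n x i j = begin
    x * idMat n i j - signedAdj s t n i j
      ≡⟨ diagonal-shift x (toℕ i ≡ᵇ toℕ j) (QEdge s t (toℕ i) (toℕ j)) (QEdge-irreflexive s t {toℕ i} {toℕ j}) ⟩
    (x + + 1) * idMat n i j + + 1 * W′ (QEdge s t (toℕ i) (toℕ j))
      ≡⟨ cong (λ e → (x + + 1) * idMat n i j + + 1 * W′ e) (QEdge-vertexRole s t (toℕ i) (toℕ j)) ⟩
    (x + + 1) * idMat n i j + + 1 * W (vertexRole s t (toℕ i)) (vertexRole s t (toℕ j))
      ≡⟨ sym (cong₃ (λ μ r r′ → (x + + 1) * idMat n i j + μ * W r r′) (cong +_ (signedLabels-weight s t (toℕ i)))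
                    (signedLabels-role s t (toℕ i)) (signedLabels-role s t (toℕ j))) ⟩
    labelMatrix (x + + 1) n (signedLabels s t) i j ∎
    where
    open ≡-Reasoning
    W′ : Bool → ℤ
    W′ e = if e then + 1 else - + 1

  opaque
    unfolding labelDet

    charPoly≡labelDet : ∀ s t n x → charPoly n (signedAdj s t n) x ≡ labelDet (x + + 1) n (signedLabels s t)
    charPoly≡labelDet s t n x =
      det-cong n {λ i j → x * idMat n i j - signedAdj s t n i j} {labelMatrix (x + + 1) n (signedLabels s t)}
        (charMatrix≡labelMatrix s t n x)

  replicate-const : ∀ r x m → (replicate r x ++ˢ λ _ → x) m ≡ x
  replicate-const zero    x m       = refl
  replicate-const (suc r) x zero    = refl
  replicate-const (suc r) x (suc m) = replicate-const r x m

  ++ˢ-cong : ∀ xs {g h : Seq} → (∀ m → g m ≡ h m) → ∀ m → (xs ++ˢ g) m ≡ (xs ++ˢ h) m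
  ++ˢ-cong []       g≗h m       = g≗h m
  ++ˢ-cong (x ∷ xs) g≗h zero    = refl
  ++ˢ-cong (x ∷ xs) g≗h (suc m) = ++ˢ-cong xs g≗h m

  labelDet-collapse-pendants : ∀ (y : ℤ) p q u →
    labelDet y (suc p ℕ.+ suc q ℕ.+ 4 ℕ.+ u) (signedLabels (suc p) (suc q))
      ≡ y ^ p * (y ^ q * labelDet y (6 ℕ.+ u) (quotientSeq (suc p) (suc q) λ _ → far₁))
  labelDet-collapse-pendants y p q u = begin
    labelDet y (suc p ℕ.+ suc q ℕ.+ 4 ℕ.+ u) (signedLabels (suc p) (suc q))
      ≡⟨ labelDet-collapse-run y cycle (outer pendant₁) 1 p (replicate (suc q) (outer pendant₂ , 1) ++ˢ λ _ → far₁)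
           (suc q ℕ.+ 4 ℕ.+ u) (size₁ p q u) (≤-trans (m≤n+m 4 (suc q)) (m≤m+n (suc q ℕ.+ 4) u)) ⟩
    y ^ p * labelDet y (suc (suc q ℕ.+ 4 ℕ.+ u)) (cycle ++ˢ (outer pendant₁ , suc p) ∷ˢ replicate (suc q) (outer pendant₂ , 1) ++ˢ λ _ → far₁)
      ≡⟨ cong (y ^ p *_) (labelDet-collapse-run y (cycle ++ (outer pendant₁ , suc p) ∷ []) (outer pendant₂) 1 q (λ _ → far₁)
           (5 ℕ.+ u) (size₂ q u) (m≤m+n 5 u)) ⟩
    y ^ p * (y ^ q * labelDet y (6 ℕ.+ u) (quotientSeq (suc p) (suc q) λ _ → far₁)) ∎
    where
    open ≡-Reasoning
    size₁ : ∀ p q u → suc p ℕ.+ suc q ℕ.+ 4 ℕ.+ u ≡ suc (p ℕ.+ (suc q ℕ.+ 4 ℕ.+ u))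
    size₁ = solve-∀
    size₂ : ∀ q u → suc (suc q ℕ.+ 4 ℕ.+ u) ≡ suc (q ℕ.+ (5 ℕ.+ u))
    size₂ = solve-∀

  labelDet-collapse-far : ∀ (y : ℤ) s t r →
    labelDet y (6 ℕ.+ suc r) (quotientSeq s t λ _ → far₁) ≡ y ^ r * labelDet y 7 (quotientSeq s t ((outer far , suc r) ∷ˢ λ _ → far₁))
  labelDet-collapse-far y s t r = begin
    labelDet y (6 ℕ.+ suc r) (quotientSeq s t λ _ → far₁)
      ≡⟨ labelDet-cong y (6 ℕ.+ suc r) (++ˢ-cong quotientPrefix (λ m → sym (replicate-const (suc r) far₁ m))) ⟩
    labelDet y (6 ℕ.+ suc r) (quotientPrefix ++ˢ far₁ ∷ˢ replicate r far₁ ++ˢ λ _ → far₁)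
      ≡⟨ labelDet-collapse-run y quotientPrefix (outer far) 1 r (λ _ → far₁) 6 (size r) ≤-refl ⟩
    y ^ r * labelDet y 7 (quotientSeq s t ((outer far , suc r) ∷ˢ λ _ → far₁)) ∎
    where
    open ≡-Reasoning
    quotientPrefix : List Label
    quotientPrefix = cycle ++ (outer pendant₁ , s) ∷ (outer pendant₂ , t) ∷ []
    size : ∀ r → 6 ℕ.+ suc r ≡ suc (r ℕ.+ 6)
    size = solve-∀

  ^-*-merge : ∀ (y : ℤ) a b F → y ^ a * (y ^ b * F) ≡ y ^ (a ℕ.+ b) * F
  ^-*-merge y a b F = trans (sym (*-assoc (y ^ a) (y ^ b) F)) (cong (_* F) (sym (^-distribˡ-+-* y a b)))

  charPoly-signedAdj : ∀ p q u x →
    (x + + 1) ^ 7 * charPoly (suc p ℕ.+ suc q ℕ.+ 4 ℕ.+ u) (signedAdj (suc p) (suc q) (suc p ℕ.+ suc q ℕ.+ 4 ℕ.+ u)) x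
      ≡ (x + + 1) ^ (suc p ℕ.+ suc q ℕ.+ 4 ℕ.+ u)
        * septicℤ (+ suc p) (+ suc q) (+ (suc p ℕ.+ suc q ℕ.+ 4 ℕ.+ u)) (+ (suc p ℕ.+ suc q ℕ.+ 4)) (+ u) x
  charPoly-signedAdj p q zero x = begin
    y ^ 7 * charPoly n (signedAdj (suc p) (suc q) n) x
      ≡⟨ cong (y ^ 7 *_) (trans (charPoly≡labelDet (suc p) (suc q) n x) (labelDet-collapse-pendants y p q 0)) ⟩
    y ^ 7 * (y ^ p * (y ^ q * D))
      ≡⟨ trans (cong (y ^ 7 *_) (^-*-merge y p q D)) (^-*-merge y 7 (p ℕ.+ q) D) ⟩
    (y * y ^ (6 ℕ.+ (p ℕ.+ q))) * D
      ≡⟨ swap y (y ^ (6 ℕ.+ (p ℕ.+ q))) D ⟩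
    y ^ (6 ℕ.+ (p ℕ.+ q)) * (y * D)
      ≡⟨ cong₂ (λ e F → y ^ e * F) (exponent p q) (labelDet-quotient₆ x (suc p) (suc q)) ⟩
    y ^ n * septicℤ (+ suc p) (+ suc q) (+ n) (+ (suc p ℕ.+ suc q ℕ.+ 4)) (+ 0) x ∎
    where
    open ≡-Reasoning
    y : ℤ
    y = x + + 1
    n : ℕ
    n = suc p ℕ.+ suc q ℕ.+ 4 ℕ.+ 0
    D : ℤ
    D = labelDet y 6 (quotientSeq (suc p) (suc q) λ _ → far₁)
    swap : ∀ a b c → (a * b) * c ≡ b * (a * c)
    swap = ℤ-Solver.solve-∀
    exponent : ∀ p q → 6 ℕ.+ (p ℕ.+ q) ≡ suc p ℕ.+ suc q ℕ.+ 4 ℕ.+ 0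
    exponent = solve-∀
  charPoly-signedAdj p q (suc r) x = begin
    y ^ 7 * charPoly n (signedAdj (suc p) (suc q) n) x
      ≡⟨ cong (y ^ 7 *_) (trans (charPoly≡labelDet (suc p) (suc q) n x) (labelDet-collapse-pendants y p q (suc r))) ⟩
    y ^ 7 * (y ^ p * (y ^ q * labelDet y (6 ℕ.+ suc r) (quotientSeq (suc p) (suc q) λ _ → far₁)))
      ≡⟨ cong (λ d → y ^ 7 * (y ^ p * (y ^ q * d))) (trans (labelDet-collapse-far y (suc p) (suc q) r) (cong (y ^ r *_) (labelDet-quotient₇ x (suc p) (suc q) (suc r)))) ⟩
    y ^ 7 * (y ^ p * (y ^ q * (y ^ r * F)))
      ≡⟨ trans (cong (λ d → y ^ 7 * (y ^ p * d)) (^-*-merge y q r F)) (trans (cong (y ^ 7 *_) (^-*-merge y p (q ℕ.+ r) F)) (^-*-merge y 7 (p ℕ.+ (q ℕ.+ r)) F)) ⟩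
    y ^ (7 ℕ.+ (p ℕ.+ (q ℕ.+ r))) * F
      ≡⟨ cong (λ e → y ^ e * F) (exponent p q r) ⟩
    y ^ n * F ∎
    where
    open ≡-Reasoning
    y : ℤ
    y = x + + 1
    n : ℕ
    n = suc p ℕ.+ suc q ℕ.+ 4 ℕ.+ suc r
    F : ℤ
    F = septicℤ (+ suc p) (+ suc q) (+ n) (+ (suc p ℕ.+ suc q ℕ.+ 4)) (+ suc r) x
    exponent : ∀ p q r → 7 ℕ.+ (p ℕ.+ (q ℕ.+ r)) ≡ suc p ℕ.+ suc q ℕ.+ 4 ℕ.+ suc r
    exponent = solve-∀

open import Defs
open import Data.Nat using (ℕ; _≤_; _+_)
open import Data.Integer using (ℤ; _*_; _^_) renaming (_+_ to _+ℤ_; +_ to ℤ+_)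
open import Relation.Binary.PropositionalEquality using (_≡_)
open import Data.Nat using (suc; _∸_; s≤s; z≤n)
open import Data.Nat.Properties using (m+[n∸m]≡n; m+n∸m≡n)
open import Relation.Binary.PropositionalEquality using (subst; cong; sym; module ≡-Reasoning)
open Quotient using (septicℤ; septic≡septicℤ)
open SignedGraph using (charPoly-signedAdj)

lemma6 : (s t n : ℕ) → 1 ≤ s → 1 ≤ t → s + t + 4 ≤ n → (x : ℤ) →
    ((x +ℤ ℤ+ 1) ^ 7) * charPoly n (signedAdj s t n) x ≡ ((x +ℤ ℤ+ 1) ^ n) * septic s t n x
lemma6 (suc p) (suc q) n (s≤s z≤n) (s≤s z≤n) k≤n x = subst statement (m+[n∸m]≡n k≤n) (at (n ∸ k))
  where
  open ≡-Reasoning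
  k : ℕ
  k = suc p + suc q + 4
  y : ℤ
  y = x +ℤ ℤ+ 1
  statement : ℕ → Set
  statement m = (y ^ 7) * charPoly m (signedAdj (suc p) (suc q) m) x ≡ (y ^ m) * septic (suc p) (suc q) m x
  at : ∀ u → statement (k + u)
  at u = begin
    (y ^ 7) * charPoly (k + u) (signedAdj (suc p) (suc q) (k + u)) x
      ≡⟨ charPoly-signedAdj p q u x ⟩
    (y ^ (k + u)) * septicℤ (ℤ+ suc p) (ℤ+ suc q) (ℤ+ (k + u)) (ℤ+ k) (ℤ+ u) x
      ≡⟨ cong (λ v → (y ^ (k + u)) * septicℤ (ℤ+ suc p) (ℤ+ suc q) (ℤ+ (k + u)) (ℤ+ k) (ℤ+ v) x) (sym (m+n∸m≡n k u)) ⟩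
    (y ^ (k + u)) * septicℤ (ℤ+ suc p) (ℤ+ suc q) (ℤ+ (k + u)) (ℤ+ k) (ℤ+ ((k + u) ∸ k)) x
      ≡⟨ cong ((y ^ (k + u)) *_) (sym (septic≡septicℤ (suc p) (suc q) (k + u) x)) ⟩
    (y ^ (k + u)) * septic (suc p) (suc q) (k + u) x ∎
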